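{- Let $\Delta\ge 3$ be an integer. For each of the $2^{\Delta-1}$ choices of symbols $\circledast_1,\dots,\circledast_{\Delta-1}\in\{=,>\}$ there exists a tree $T$ with maximum degree $\Delta$ such that $$\gamma_{11}(T)\ \circledast_1\ \gamma_{12}(T)\ \circledast_2\ \gamma_{13}(T)\ \cdots\ \gamma_{1(\Delta-1)}(T)\ \circledast_{\Delta-1}\ \gamma_{1\Delta}(T)=\gamma(T),$$ i.e. for every $i\in\{1,\dots,\Delta-1\}$, $\gamma_{1i}(T)=\gamma_{1(i+1)}(T)$ if $\circledast_i$ is "$=$", and $\gamma_{1i}(T)>\gamma_{1(i+1)}(T)$ if $\circledast_i$ is "$>$".
   Context: All graphs are finite, undirected, simple and connected; a tree is a connected acyclic graph. A set $S$ of vertices of a graph $G$ is a dominating set if every vertex not in $S$ is adjacent to at least one vertex of $S$; $\gamma(G)$ is the minimum cardinality of a dominating set. For an integer $k\ge 1$, a $k$-quasiperfect dominating set of $G$ is a dominating set $S$ such that every vertex not in $S$ is adjacent to at most $k$ vertices of $S$; $\gamma_{1k}(G)$ is the minimum cardinality of such a set. -}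

module Defs where

open import Data.Fin.Base using (Fin)
open import Data.Fin.Properties using (all?; any?)
open import Data.Fin.Subset using (Subset; _∈_; _∉_; _∩_; ∣_∣; ⊤)
open import Data.Fin.Subset.Properties using (_∈?_; ∈⊤; anySubset?)
open import Data.List.Base using (List; _∷_; _++_; [_]; length)
import Data.List.Base as List
open import Data.List.Extrema.Nat using (max)
open import Data.List.Relation.Unary.Linked using (Linked)
open import Data.List.Relation.Unary.Unique.Propositional using (Unique)
open import Data.Nat.Base using (ℕ; _≤_; _<_; _>_)
open import Data.Nat.Induction using (<-wellFounded)
open import Data.Nat.Properties using (_<?_; _≤?_; ≮⇒≥)
open import Data.Product.Base using (∃; _×_; _,_; proj₁)
open import Data.Vec.Base using (tabulate)
open import Function.Base using (_∘_)
open import Induction.WellFounded using (Acc; acc)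
open import Level using (0ℓ)
open import Relation.Binary.Core using (Rel)
open import Relation.Binary.Construct.Closure.ReflexiveTransitive using (Star)
open import Relation.Binary.Definitions using (Decidable; Irreflexive; Symmetric)
open import Relation.Binary.PropositionalEquality using (_≡_; refl)
open import Relation.Nullary using (¬_; ¬?; yes; no; does; contradiction; _×-dec_; _→-dec_)
import Relation.Unary as U

record Graph : Set₁ where
  infix 4 _∼_ _∼?_
  field
    order  : ℕ
    _∼_    : Rel (Fin order) 0ℓ
    _∼?_   : Decidable _∼_
    sym    : Symmetric _∼_
    irrefl : Irreflexive _≡_ _∼_

  Vertex : Set
  Vertex = Fin order

  neighbours : Vertex → Subset order
  neighbours v = tabulate (does ∘ (v ∼?_))

  degree : Vertex → ℕ
  degree v = ∣ neighbours v ∣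

  maxDegree : ℕ
  maxDegree = max 0 (List.tabulate degree)

  -- The empty graph does not count as connected.
  Connected : Set
  Connected = 0 < order × (∀ u v → Star _∼_ u v)

  -- The cycle v , vs₁ , … , vsₘ , v, whose m + 1 ≥ 3 vertices are distinct.
  IsCycle : Vertex → List Vertex → Set
  IsCycle v vs = 2 ≤ length vs × Unique (v ∷ vs) × Linked _∼_ (v ∷ vs ++ [ v ])

  Acyclic : Set
  Acyclic = ∀ v vs → ¬ IsCycle v vs

  IsTree : Set
  IsTree = Connected × Acyclic

  Dominating : U.Pred (Subset order) 0ℓ
  Dominating S = ∀ v → v ∉ S → ∃ λ u → u ∈ S × v ∼ u

  QuasiperfectDominating : ℕ → U.Pred (Subset order) 0ℓ
  QuasiperfectDominating k S =
    Dominating S × (∀ v → v ∉ S → ∣ neighbours v ∩ S ∣ ≤ k)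

  dominating? : U.Decidable Dominating
  dominating? S = all? λ v →
    ¬? (v ∈? S) →-dec any? λ u → (u ∈? S) ×-dec (v ∼? u)

  quasiperfectDominating? : ∀ k → U.Decidable (QuasiperfectDominating k)
  quasiperfectDominating? k S = dominating? S ×-dec all? λ v →
    ¬? (v ∈? S) →-dec (∣ neighbours v ∩ S ∣ ≤? k)

  dominating-⊤ : Dominating ⊤
  dominating-⊤ v v∉⊤ = contradiction ∈⊤ v∉⊤

  quasiperfectDominating-⊤ : ∀ k → QuasiperfectDominating k ⊤
  quasiperfectDominating-⊤ k = dominating-⊤ , λ v v∉⊤ → contradiction ∈⊤ v∉⊤

module _ {n : ℕ} (P : U.Pred (Subset n) 0ℓ) where

  IsMinimumCardinality : ℕ → Set
  IsMinimumCardinality m =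
    (∃ λ S → P S × ∣ S ∣ ≡ m) × (∀ S → P S → m ≤ ∣ S ∣)

  minimumCardinality : U.Decidable P → ∃ P → ∃ IsMinimumCardinality
  minimumCardinality P? (S₀ , p₀) = descend S₀ p₀ (<-wellFounded ∣ S₀ ∣)
    where
    descend : ∀ S → P S → Acc _<_ ∣ S ∣ → ∃ IsMinimumCardinality
    descend S p (acc rs) with anySubset? (λ S′ → P? S′ ×-dec (∣ S′ ∣ <? ∣ S ∣))
    ... | yes (S′ , p′ , S′<S) = descend S′ p′ (rs S′<S)
    ... | no  ∄S′ = ∣ S ∣ , (S , p , refl) , λ S′ p′ → ≮⇒≥ λ S′<S → ∄S′ (S′ , p′ , S′<S)

module _ (G : Graph) where
  open Graph G

  γ : ℕ
  γ = proj₁ (minimumCardinality Dominating dominating? (⊤ , dominating-⊤))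

  -- γ₁ k is γ_{1k}, the notion being meant for k ≥ 1.
  γ₁ : ℕ → ℕ
  γ₁ k = proj₁ (minimumCardinality (QuasiperfectDominating k)
    (quasiperfectDominating? k) (⊤ , quasiperfectDominating-⊤ k))

data Symbol : Set where
  equal greater : Symbol

⟦_⟧ : Symbol → Rel ℕ 0ℓ
⟦ equal   ⟧ = _≡_
⟦ greater ⟧ = _>_

{-# OPTIONS --safe #-}
module Submission where

-- Let a vertex v be adjacent to exactly d vertices u₁, …, u_d, each of them with two
-- private neighbours. The d vertices uᵢ dominate everything, and v sees d of them; so
-- this gadget costs d if d ≤ k. If d > k, then v must be taken or some uᵢ must be given
-- up in favour of its two private neighbours, and the cost is d + 1. Hence a gadget
-- with d = i + 1 makes γ_{1i} drop by one from i to i + 1, and only there.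
--
-- The tree has one such gadget for every symbol >, and costs add up because the
-- gadgets do not interact: one private neighbour w of u₁ is joined to a vertex z which
-- is adjacent to a vertex c with a leaf. Since c or its leaf is taken anyway, taking z
-- (the only way for the outside to dominate w) costs as much as it saves. Along the
-- spine z − c − l − z′ − c′ − l′ − … only the c's are taken.

open import Data.Bool.Base using (Bool; true; false; if_then_else_; _∧_)
open import Data.Empty using (⊥)
open import Data.Fin.Base as Fin using (Fin; zero; suc; toℕ; splitAt; _↑ˡ_; _↑ʳ_; join)
open import Data.Fin.Properties as Fin
  using (_≟_; toℕ<n; toℕ-↑ˡ; toℕ-↑ʳ; splitAt-join; join-splitAt; splitAt-↑ˡ; splitAt-↑ʳ)
open import Data.Fin.Subset using (Subset; _∈_; _∉_; _∩_; ∣_∣; Nonempty) renaming (⊤ to full)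
open import Data.Fin.Subset.Properties using (∣p∣≤∣x∷p∣; ∣p∩q∣≤∣p∣; x∈p∩q⁺; x∈p∩q⁻; ∩-identityʳ)
open import Data.List.Base as List using (List; []; _∷_; [_])
open import Data.List.Extrema.Nat using (max≤v⁺; xs≤max)
open import Data.List.Membership.Propositional as List using ()
open import Data.List.Membership.Propositional.Properties using (∈-tabulate⁺)
open import Data.List.Relation.Unary.All as All using (All; []; _∷_)
import Data.List.Relation.Unary.All.Properties as All
open import Data.List.Relation.Unary.AllPairs using ([]; _∷_)
open import Data.List.Relation.Unary.Any using (here; there)
open import Data.List.Relation.Unary.Linked using (Linked; _∷_)
open import Data.List.Relation.Unary.Unique.Propositional using (Unique)
open import Data.Nat.Base using (ℕ; zero; suc; _+_; _∸_; _≤_; _<_; z≤n; s≤s)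
open import Data.Nat.Properties hiding (_≟_)
open import Data.Product.Base using (Σ-syntax; ∃; ∃-syntax; _×_; _,_; proj₁; proj₂; swap)
open import Data.Sum.Base as Sum using (_⊎_; inj₁; inj₂; [_,_]′)
open import Data.Unit.Base using (⊤; tt)
open import Data.Vec.Base as Vec using (Vec; []; _∷_; _++_; lookup; tabulate; replicate)
open import Data.Vec.Properties
  using (lookup-++ˡ; lookup-++ʳ; zipWith-++; lookup∘tabulate; lookup⇒[]=; []=⇒lookup)
open import Function.Base using (_∘_; _on_; case_of_; id)
open import Level using (0ℓ)
open import Relation.Binary.Core using (Rel)
open import Relation.Binary.Construct.Closure.ReflexiveTransitive using (Star; ε; _◅_; _◅◅_; gmap)
open import Relation.Binary.Definitions using (Decidable; Symmetric; tri<; tri≈; tri>)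
open import Relation.Binary.PropositionalEquality
  using (_≡_; _≢_; refl; sym; trans; cong; cong₂; subst; subst₂; ≢-sym)
open import Relation.Nullary.Decidable using (dec-true; dec-false)
open import Relation.Nullary using (¬_; yes; no; does; contradiction; _×-dec_)
open import Defs

𝟙 : Bool → ℕ
𝟙 b = if b then 1 else 0

-- Acyclicity from a numbering of the vertices

module _ (G : Graph) where
  open Graph G renaming (sym to ∼-sym)

  -- A certificate of acyclicity, met by numbering parents before children: on a cycle, the highest
  -- vertex would have two lower neighbours.
  UniqueLowerNeighbours : Set
  UniqueLowerNeighbours =
    ∀ a b v → a ∼ v → b ∼ v → a Fin.< v → b Fin.< v → a ≡ b

  module _ (unique : UniqueLowerNeighbours) where

    private
      up-or-down : ∀ {u v} → u ∼ v → u Fin.< v ⊎ v Fin.< u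
      up-or-down {u} {v} u∼v with Fin.<-cmp u v
      ... | tri< u<v _ _ = inj₁ u<v
      ... | tri≈ _ u≡v _ = contradiction u∼v (irrefl u≡v)
      ... | tri> _ _ v<u = inj₂ v<u

      LastStepUp : Vertex → List Vertex → Set
      LastStepUp e vs = ∃[ l ] (l List.∈ vs × l ∼ e × l Fin.< e)

      weaken : ∀ {e v vs} → LastStepUp e vs → LastStepUp e (v ∷ vs)
      weaken (l , l∈vs , l∼e , l<e) = l , there l∈vs , l∼e , l<e

      -- A walk that never turns back cannot step up and then down, since both
      -- neighbours of the turning point would lie below it.
      descend-ascend : ∀ {e} a b vs → Unique (a ∷ b ∷ vs) → All (_≢ e) (a ∷ b ∷ vs) →
        Linked _∼_ (a ∷ b ∷ vs List.++ [ e ]) →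
        (b Fin.< a × (e Fin.< a ⊎ LastStepUp e (b ∷ vs))) ⊎
        (a Fin.< b × a Fin.< e × LastStepUp e (b ∷ vs))
      descend-ascend a b [] _ (a≢e ∷ _) (a∼b ∷ b∼e ∷ _)
        with up-or-down a∼b | up-or-down b∼e
      ... | inj₁ a<b | inj₁ b<e = inj₂ (a<b , Fin.<-trans a<b b<e , b , here refl , b∼e , b<e)
      ... | inj₁ a<b | inj₂ e<b = contradiction (unique _ _ _ a∼b (∼-sym b∼e) a<b e<b) a≢e
      ... | inj₂ b<a | inj₁ b<e = inj₁ (b<a , inj₂ (b , here refl , b∼e , b<e))
      ... | inj₂ b<a | inj₂ e<b = inj₁ (b<a , inj₁ (Fin.<-trans e<b b<a))
      descend-ascend a b (c ∷ vs) ((_ ∷ a≢c ∷ _) ∷ distinct) (_ ∷ ≢e) (a∼b ∷ walk@(b∼c ∷ _))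
        with up-or-down a∼b | descend-ascend b c vs distinct ≢e walk
      ... | inj₁ a<b | inj₁ (c<b , _) = contradiction (unique _ _ _ a∼b (∼-sym b∼c) a<b c<b) a≢c
      ... | inj₁ a<b | inj₂ (_ , b<e , up) = inj₂ (a<b , Fin.<-trans a<b b<e , weaken up)
      ... | inj₂ b<a | inj₁ (_ , inj₁ e<b) = inj₁ (b<a , inj₁ (Fin.<-trans e<b b<a))
      ... | inj₂ b<a | inj₁ (_ , inj₂ up) = inj₁ (b<a , inj₂ (weaken up))
      ... | inj₂ b<a | inj₂ (_ , _ , up) = inj₁ (b<a , inj₂ (weaken up))

    -- If the cycle leaves `v` upwards, it must keep rising and cannot return to `v`. If it leaves
    -- downwards to `a`, it must come back up from some `l` other than `a`, and `v` has two lower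
    -- neighbours.
    uniqueLowerNeighbours⇒acyclic : Acyclic
    uniqueLowerNeighbours⇒acyclic v [] (() , _)
    uniqueLowerNeighbours⇒acyclic v (_ ∷ []) (s≤s () , _)
    uniqueLowerNeighbours⇒acyclic v (a ∷ b ∷ vs)
      (_ , v≢@(_ ∷ v≢b ∷ _) ∷ distinct@(a≢ ∷ _) , v∼a ∷ walk@(a∼b ∷ _))
      with up-or-down v∼a | descend-ascend a b vs distinct (All.map ≢-sym v≢) walk
    ... | inj₁ v<a | inj₁ (b<a , _) = v≢b (unique _ _ _ v∼a (∼-sym a∼b) v<a b<a)
    ... | inj₁ v<a | inj₂ (_ , a<v , _) = Fin.<-asym v<a a<v
    ... | inj₂ a<v | inj₁ (_ , inj₁ v<a) = Fin.<-asym v<a a<v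
    ... | inj₂ a<v | inj₁ (_ , inj₂ (l , l∈ , l∼v , l<v)) =
      All.lookup a≢ l∈ (unique _ _ _ (∼-sym v∼a) l∼v a<v l<v)
    ... | inj₂ a<v | inj₂ (_ , _ , l , l∈ , l∼v , l<v) =
      All.lookup a≢ l∈ (unique _ _ _ (∼-sym v∼a) l∼v a<v l<v)

-- Subsets of a disjoint union

onJoin : ∀ {m n} {P : Fin (m + n) → Set} → (∀ w → P (join m n w)) → ∀ v → P v
onJoin {m} {n} {P} p v = subst P (join-splitAt m n v) (p (splitAt m v))

↑ʳ≢↑ˡ : ∀ {m n} (a : Fin m) (b : Fin n) → m ↑ʳ b ≢ a ↑ˡ n
↑ʳ≢↑ˡ {m} {n} a b eq
  with () ← trans (sym (splitAt-↑ʳ m n b)) (trans (cong (splitAt m) eq) (splitAt-↑ˡ m a n))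

tabulate-splitAt : ∀ {A : Set} m {n} (f : Fin m ⊎ Fin n → A) →
  tabulate (f ∘ splitAt m) ≡ tabulate (f ∘ inj₁) ++ tabulate (f ∘ inj₂)
tabulate-splitAt zero    f = refl
tabulate-splitAt (suc m) f = cong (f (inj₁ zero) ∷_) (tabulate-splitAt m (f ∘ Sum.map suc id))

∣p++q∣≡∣p∣+∣q∣ : ∀ {m n} (p : Subset m) (q : Subset n) → ∣ p ++ q ∣ ≡ ∣ p ∣ + ∣ q ∣
∣p++q∣≡∣p∣+∣q∣ []          q = refl
∣p++q∣≡∣p∣+∣q∣ (true  ∷ p) q = cong suc (∣p++q∣≡∣p∣+∣q∣ p q)
∣p++q∣≡∣p∣+∣q∣ (false ∷ p) q = ∣p++q∣≡∣p∣+∣q∣ p q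

∣empty∩p∣≡0 : ∀ {n} (p : Subset n) → ∣ tabulate (λ _ → false) ∩ p ∣ ≡ 0
∣empty∩p∣≡0 []      = refl
∣empty∩p∣≡0 (_ ∷ p) = ∣empty∩p∣≡0 p

∣singleton∩p∣ : ∀ {n} (x : Fin n) (p : Subset n) →
  ∣ tabulate (λ y → does (y ≟ x)) ∩ p ∣ ≡ 𝟙 (lookup p x)
∣singleton∩p∣ zero    (true  ∷ p) = cong suc (∣empty∩p∣≡0 p)
∣singleton∩p∣ zero    (false ∷ p) = ∣empty∩p∣≡0 p
∣singleton∩p∣ (suc x) (_ ∷ p)     = ∣singleton∩p∣ x p

-- The neighbourhood across a linking edge has this form: `b` tells whether the vertex at hand is
-- one end of the edge, and `x` is the other end.
∣restricted-singleton∩p∣ : ∀ {n} b (x : Fin n) (p : Subset n) →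
  ∣ tabulate (λ y → b ∧ does (y ≟ x)) ∩ p ∣ ≡ (if b then 𝟙 (lookup p x) else 0)
∣restricted-singleton∩p∣ true  x p = ∣singleton∩p∣ x p
∣restricted-singleton∩p∣ false x p = ∣empty∩p∣≡0 p

x∈p⇒1≤∣p∣ : ∀ {n} {x : Fin n} {p : Subset n} → x ∈ p → 1 ≤ ∣ p ∣
x∈p⇒1≤∣p∣ Vec.here                     = s≤s z≤n
x∈p⇒1≤∣p∣ {p = b ∷ p} (Vec.there x∈p) = ≤-trans (x∈p⇒1≤∣p∣ x∈p) (∣p∣≤∣x∷p∣ b p)

1≤∣p∣⇒nonempty : ∀ {n} (p : Subset n) → 1 ≤ ∣ p ∣ → Nonempty p
1≤∣p∣⇒nonempty (true  ∷ p) _ = zero , Vec.here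
1≤∣p∣⇒nonempty (false ∷ p) 1≤∣p∣ with x , x∈p ← 1≤∣p∣⇒nonempty p 1≤∣p∣ = suc x , Vec.there x∈p

-- Joining two graphs by an edge

module _ (G H : Graph) (x : Graph.Vertex G) (y : Graph.Vertex H) where
  private
    module G = Graph G
    module H = Graph H
    m = G.order
    n = H.order

  infix 4 _⊎∼_ _⊎∼?_

  _⊎∼_ : Rel (G.Vertex ⊎ H.Vertex) 0ℓ
  inj₁ a ⊎∼ inj₁ b = a G.∼ b
  inj₁ a ⊎∼ inj₂ b = a ≡ x × b ≡ y
  inj₂ a ⊎∼ inj₁ b = a ≡ y × b ≡ x
  inj₂ a ⊎∼ inj₂ b = a H.∼ b

  _⊎∼?_ : Decidable _⊎∼_
  inj₁ a ⊎∼? inj₁ b = a G.∼? b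
  inj₁ a ⊎∼? inj₂ b = a ≟ x ×-dec b ≟ y
  inj₂ a ⊎∼? inj₁ b = a ≟ y ×-dec b ≟ x
  inj₂ a ⊎∼? inj₂ b = a H.∼? b

  ⊎∼-sym : Symmetric _⊎∼_
  ⊎∼-sym {inj₁ a} {inj₁ b} = G.sym
  ⊎∼-sym {inj₁ a} {inj₂ b} = swap
  ⊎∼-sym {inj₂ a} {inj₁ b} = swap
  ⊎∼-sym {inj₂ a} {inj₂ b} = H.sym

  ⊎∼-irrefl : ∀ a → ¬ a ⊎∼ a
  ⊎∼-irrefl (inj₁ a) = G.irrefl refl
  ⊎∼-irrefl (inj₂ a) = H.irrefl refl

  link : Graph
  link = record
    { order  = m + n
    ; _∼_    = _⊎∼_ on splitAt m
    ; _∼?_   = λ u v → splitAt m u ⊎∼? splitAt m v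
    ; sym    = λ {u} {v} → ⊎∼-sym {splitAt m u} {splitAt m v}
    ; irrefl = λ { {u} refl → ⊎∼-irrefl (splitAt m u) }
    }

  private
    module L = Graph link

  link-∼⁺ : ∀ u v → u ⊎∼ v → join m n u L.∼ join m n v
  link-∼⁺ u v rewrite splitAt-join m n u | splitAt-join m n v = id

  link-∼⁻ : ∀ u v → join m n u L.∼ join m n v → u ⊎∼ v
  link-∼⁻ u v rewrite splitAt-join m n u | splitAt-join m n v = id

  private
    ∣link-neighbours∩∣ : ∀ v (p : Subset m) (q : Subset n) →
      ∣ L.neighbours (join m n v) ∩ (p ++ q) ∣ ≡
      ∣ tabulate (does ∘ (v ⊎∼?_) ∘ inj₁) ∩ p ∣ + ∣ tabulate (does ∘ (v ⊎∼?_) ∘ inj₂) ∩ q ∣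
    ∣link-neighbours∩∣ v p q
      rewrite splitAt-join m n v
            | tabulate-splitAt m (does ∘ (v ⊎∼?_))
            | zipWith-++ _∧_ (tabulate (does ∘ (v ⊎∼?_) ∘ inj₁)) (tabulate (does ∘ (v ⊎∼?_) ∘ inj₂)) p q
      = ∣p++q∣≡∣p∣+∣q∣ (tabulate (does ∘ (v ⊎∼?_) ∘ inj₁) ∩ p) (tabulate (does ∘ (v ⊎∼?_) ∘ inj₂) ∩ q)

  ∣link-neighboursˡ∩∣ : ∀ a (p : Subset m) (q : Subset n) →
    ∣ L.neighbours (a ↑ˡ n) ∩ (p ++ q) ∣ ≡
    ∣ G.neighbours a ∩ p ∣ + (if does (a ≟ x) then 𝟙 (lookup q y) else 0)
  ∣link-neighboursˡ∩∣ a p q = trans (∣link-neighbours∩∣ (inj₁ a) p q)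
    (cong (∣ G.neighbours a ∩ p ∣ +_) (∣restricted-singleton∩p∣ (does (a ≟ x)) y q))

  ∣link-neighboursʳ∩∣ : ∀ b (p : Subset m) (q : Subset n) →
    ∣ L.neighbours (m ↑ʳ b) ∩ (p ++ q) ∣ ≡
    (if does (b ≟ y) then 𝟙 (lookup p x) else 0) + ∣ H.neighbours b ∩ q ∣
  ∣link-neighboursʳ∩∣ b p q = trans (∣link-neighbours∩∣ (inj₂ b) p q)
    (cong (_+ ∣ H.neighbours b ∩ q ∣) (∣restricted-singleton∩p∣ (does (b ≟ y)) x p))

  link-connected : G.Connected → H.Connected → L.Connected
  link-connected (0<m , pathᴳ) (_ , pathᴴ) =
    ≤-trans 0<m (m≤m+n m n) , onJoin λ u → onJoin λ v → path u v
    where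
    pathˡ : ∀ a b → Star L._∼_ (a ↑ˡ n) (b ↑ˡ n)
    pathˡ a b = gmap (_↑ˡ n) (λ {c} {d} → link-∼⁺ (inj₁ c) (inj₁ d)) (pathᴳ a b)

    pathʳ : ∀ a b → Star L._∼_ (m ↑ʳ a) (m ↑ʳ b)
    pathʳ a b = gmap (m ↑ʳ_) (λ {c} {d} → link-∼⁺ (inj₂ c) (inj₂ d)) (pathᴴ a b)

    path : ∀ u v → Star L._∼_ (join m n u) (join m n v)
    path (inj₁ a) (inj₁ b) = pathˡ a b
    path (inj₁ a) (inj₂ b) =
      pathˡ a x ◅◅ link-∼⁺ (inj₁ x) (inj₂ y) (refl , refl) ◅ pathʳ y b
    path (inj₂ a) (inj₁ b) =
      pathʳ a y ◅◅ link-∼⁺ (inj₂ y) (inj₁ x) (refl , refl) ◅ pathˡ x b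
    path (inj₂ a) (inj₂ b) = pathʳ a b

  -- All of `H` is numbered after `G`, so the new edge adds a lower neighbour only to `y`. By
  -- `toℕ y ≡ 0`, `y` had none within `H`.
  link-uniqueLowerNeighbours : toℕ y ≡ 0 →
    UniqueLowerNeighbours G → UniqueLowerNeighbours H → UniqueLowerNeighbours link
  link-uniqueLowerNeighbours y≡0 uniqueᴳ uniqueᴴ =
    onJoin λ a → onJoin λ b → onJoin λ v a∼v b∼v → unique a b v (link-∼⁻ a v a∼v) (link-∼⁻ b v b∼v)
    where
    lowerˡ : ∀ {a b} → a ↑ˡ n Fin.< b ↑ˡ n → a Fin.< b
    lowerˡ {a} {b} a<b rewrite toℕ-↑ˡ a n | toℕ-↑ˡ b n = a<b

    lowerʳ : ∀ {a b} → m ↑ʳ a Fin.< m ↑ʳ b → a Fin.< b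
    lowerʳ {a} {b} a<b rewrite toℕ-↑ʳ m a | toℕ-↑ʳ m b = +-cancelˡ-< m _ _ a<b

    left<right : ∀ a b → a ↑ˡ n Fin.< m ↑ʳ b
    left<right a b rewrite toℕ-↑ˡ a n | toℕ-↑ʳ m b = ≤-trans (toℕ<n a) (m≤m+n m _)

    y-lowest : ∀ {b} → ¬ (m ↑ʳ b Fin.< m ↑ʳ y)
    y-lowest {b} b<y with () ← subst (toℕ b <_) y≡0 (lowerʳ b<y)

    unique : ∀ a b v → a ⊎∼ v → b ⊎∼ v →
      join m n a Fin.< join m n v → join m n b Fin.< join m n v → join m n a ≡ join m n b
    unique (inj₁ a) (inj₁ b) (inj₁ v) a∼v b∼v a<v b<v =
      cong (_↑ˡ n) (uniqueᴳ a b v a∼v b∼v (lowerˡ a<v) (lowerˡ b<v))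
    unique (inj₂ a) _        (inj₁ v) _ _ a<v _ = contradiction a<v (Fin.<-asym (left<right v a))
    unique _        (inj₂ b) (inj₁ v) _ _ _ b<v = contradiction b<v (Fin.<-asym (left<right v b))
    unique (inj₁ _) (inj₁ _) (inj₂ _) (refl , _) (refl , _) _ _ = refl
    unique (inj₁ _) (inj₂ _) (inj₂ _) (_ , refl) _ _ b<y = contradiction b<y y-lowest
    unique (inj₂ _) (inj₁ _) (inj₂ _) _ (_ , refl) a<y _ = contradiction a<y y-lowest
    unique (inj₂ a) (inj₂ b) (inj₂ v) a∼v b∼v a<v b<v =
      cong (m ↑ʳ_) (uniqueᴴ a b v a∼v b∼v (lowerʳ a<v) (lowerʳ b<v))

-- Rooted plane trees and their graphs

infixl 6 _▹_

-- s ▹ t hangs t below the root of s as a new last branch, so every rooted plane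
-- tree is obtained exactly once.
data Tree : Set where
  •   : Tree
  _▹_ : Tree → Tree → Tree

point : Graph
point = record
  { order  = 1
  ; _∼_    = λ _ _ → ⊥
  ; _∼?_   = λ _ _ → no id
  ; sym    = id
  ; irrefl = λ _ ()
  }

graph : Tree → Graph
root  : ∀ t → Graph.Vertex (graph t)

graph •       = point
graph (s ▹ t) = link (graph s) (graph t) (root s) (root t)

root •       = zero
root (s ▹ t) = root s ↑ˡ Graph.order (graph t)

toℕ-root : ∀ t → toℕ (root t) ≡ 0
toℕ-root •       = refl
toℕ-root (s ▹ t) = trans (toℕ-↑ˡ (root s) _) (toℕ-root s)

graph-connected : ∀ t → Graph.Connected (graph t)
graph-connected •       = s≤s z≤n , λ { zero zero → ε }
graph-connected (s ▹ t) =
  link-connected (graph s) (graph t) (root s) (root t) (graph-connected s) (graph-connected t)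

graph-uniqueLowerNeighbours : ∀ t → UniqueLowerNeighbours (graph t)
graph-uniqueLowerNeighbours •       _ _ _ ()
graph-uniqueLowerNeighbours (s ▹ t) =
  link-uniqueLowerNeighbours (graph s) (graph t) (root s) (root t) (toℕ-root t)
    (graph-uniqueLowerNeighbours s) (graph-uniqueLowerNeighbours t)

graph-isTree : ∀ t → Graph.IsTree (graph t)
graph-isTree t = graph-connected t ,
  uniqueLowerNeighbours⇒acyclic (graph t) (graph-uniqueLowerNeighbours t)

-- Vertex subsets as labellings

-- A subset stored in the shape of the tree, so that case analysis on the labels of particular
-- vertices is pattern matching, free of index arithmetic.
Labelling : Tree → Set
Labelling •       = Bool
Labelling (s ▹ t) = Labelling s × Labelling t

rootLabel : ∀ t → Labelling t → Bool
rootLabel •       b       = b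
rootLabel (s ▹ t) (K , L) = rootLabel s K

weight : ∀ t → Labelling t → ℕ
weight •       b       = 𝟙 b
weight (s ▹ t) (K , L) = weight s K + weight t L

subset : ∀ t → Labelling t → Subset (Graph.order (graph t))
subset •       b       = b ∷ []
subset (s ▹ t) (K , L) = subset s K ++ subset t L

∣subset∣ : ∀ t L → ∣ subset t L ∣ ≡ weight t L
∣subset∣ •       true    = refl
∣subset∣ •       false   = refl
∣subset∣ (s ▹ t) (K , L) =
  trans (∣p++q∣≡∣p∣+∣q∣ (subset s K) (subset t L)) (cong₂ _+_ (∣subset∣ s K) (∣subset∣ t L))

lookup-root : ∀ t L → lookup (subset t L) (root t) ≡ rootLabel t L
lookup-root •       b       = refl
lookup-root (s ▹ t) (K , L) = trans (lookup-++ˡ (subset s K) (subset t L) (root s)) (lookup-root s K)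

subset-surjective : ∀ t S → ∃ λ L → subset t L ≡ S
subset-surjective • (b ∷ []) = b , refl
subset-surjective (s ▹ t) S
  with p , q , refl ← Vec.splitAt (Graph.order (graph s)) S
  with K , refl ← subset-surjective s p
  with L , refl ← subset-surjective t q = (K , L) , refl

allInside : ∀ t → Labelling t
allInside •       = true
allInside (s ▹ t) = allInside s , allInside t

rootLabel-allInside : ∀ t → rootLabel t (allInside t) ≡ true
rootLabel-allInside •       = refl
rootLabel-allInside (s ▹ t) = rootLabel-allInside s

replicate-++ : ∀ {A : Set} m {n} (x : A) → replicate m x ++ replicate n x ≡ replicate (m + n) x
replicate-++ zero    x = refl
replicate-++ (suc m) x = cong (x ∷_) (replicate-++ m x)

subset-allInside : ∀ t → subset t (allInside t) ≡ full
subset-allInside •       = refl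
subset-allInside (s ▹ t) rewrite subset-allInside s | subset-allInside t =
  replicate-++ (Graph.order (graph s)) true

-- Every vertex satisfies P at its label and its number of inside neighbours,
-- where the root is given c further inside neighbours outside the tree.
Each : (Bool → ℕ → Set) → ∀ t → Labelling t → ℕ → Set
Each P •       b       c = P b c
Each P (s ▹ t) (K , L) c = Each P s K (𝟙 (rootLabel t L) + c) × Each P t L (𝟙 (rootLabel s K))

-- The extra `c` makes the count hereditary: when a branch is cut off, the label at the far end of
-- the cut edge is passed on through `c`. For `c = 0` it is the count in the whole graph.
inside : ∀ t → Labelling t → ℕ → Graph.Vertex (graph t) → ℕ
inside t L c v =
  (if does (v ≟ root t) then c else 0) + ∣ Graph.neighbours (graph t) v ∩ subset t L ∣

module _ (s t : Tree) (K : Labelling s) (L : Labelling t) (c : ℕ) where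
  private
    m = Graph.order (graph s)
    n = Graph.order (graph t)

  inside-↑ˡ : ∀ a → inside (s ▹ t) (K , L) c (a ↑ˡ n) ≡ inside s K (𝟙 (rootLabel t L) + c) a
  inside-↑ˡ a
    rewrite ∣link-neighboursˡ∩∣ (graph s) (graph t) (root s) (root t) a (subset s K) (subset t L)
          | lookup-root t L
    with a ≟ root s
  ... | yes refl rewrite dec-true (root s ↑ˡ n ≟ root s ↑ˡ n) refl
    | +-comm (𝟙 (rootLabel t L)) c
    | +-assoc c (𝟙 (rootLabel t L)) ∣ Graph.neighbours (graph s) (root s) ∩ subset s K ∣
    = cong (c +_) (+-comm _ (𝟙 (rootLabel t L)))
  ... | no a≢root rewrite dec-false (a ↑ˡ n ≟ root s ↑ˡ n) (a≢root ∘ Fin.↑ˡ-injective n a (root s))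
    = +-identityʳ _

  inside-↑ʳ : ∀ b → inside (s ▹ t) (K , L) c (m ↑ʳ b) ≡ inside t L (𝟙 (rootLabel s K)) b
  inside-↑ʳ b
    rewrite ∣link-neighboursʳ∩∣ (graph s) (graph t) (root s) (root t) b (subset s K) (subset t L)
          | lookup-root s K
          | dec-false (m ↑ʳ b ≟ root s ↑ˡ n) (↑ʳ≢↑ˡ (root s) b)
    = refl

module _ {P : Bool → ℕ → Set} where

  each⁺ : ∀ t L c → (∀ v → P (lookup (subset t L) v) (inside t L c v)) → Each P t L c
  each⁺ •       b       c p = subst (P b) (+-identityʳ c) (p zero)
  each⁺ (s ▹ t) (K , L) c p =
    each⁺ s K _ (λ a → subst₂ P (lookup-++ˡ (subset s K) _ a) (inside-↑ˡ s t K L c a) (p _)) ,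
    each⁺ t L _ (λ b → subst₂ P (lookup-++ʳ (subset s K) _ b) (inside-↑ʳ s t K L c b) (p _))

  each⁻ : ∀ t L c → Each P t L c → ∀ v → P (lookup (subset t L) v) (inside t L c v)
  each⁻ •       b       c p zero = subst (P b) (sym (+-identityʳ c)) p
  each⁻ (s ▹ t) (K , L) c (p , q) = onJoin λ
    { (inj₁ a) → subst₂ P (sym (lookup-++ˡ (subset s K) _ a)) (sym (inside-↑ˡ s t K L c a))
                   (each⁻ s K _ p a)
    ; (inj₂ b) → subst₂ P (sym (lookup-++ʳ (subset s K) _ b)) (sym (inside-↑ʳ s t K L c b))
                   (each⁻ t L _ q b)
    }

inside-0 : ∀ t L v → inside t L 0 v ≡ ∣ Graph.neighbours (graph t) v ∩ subset t L ∣
inside-0 t L v with does (v ≟ root t)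
... | true  = refl
... | false = refl

-- Domination and degrees as local conditions

module _ (G : Graph) where
  open Graph G hiding (sym)

  v∼u⇒u∈neighbours : ∀ {u v} → v ∼ u → u ∈ neighbours v
  v∼u⇒u∈neighbours {u} {v} v∼u = lookup⇒[]= u (neighbours v)
    (trans (lookup∘tabulate (does ∘ (v ∼?_)) u) (dec-true (v ∼? u) v∼u))

  u∈neighbours⇒v∼u : ∀ {u v} → u ∈ neighbours v → v ∼ u
  u∈neighbours⇒v∼u {u} {v} u∈N
    with eq ← trans (sym (lookup∘tabulate (does ∘ (v ∼?_)) u)) ([]=⇒lookup u∈N)
    with v ∼? u
  ... | yes v∼u = v∼u

  maxDegree≤⁺ : ∀ {n} → (∀ v → degree v ≤ n) → maxDegree ≤ n
  maxDegree≤⁺ degree≤n = max≤v⁺ {xs = List.tabulate degree} z≤n (All.tabulate⁺ degree≤n)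

  degree≤maxDegree : ∀ v → degree v ≤ maxDegree
  degree≤maxDegree = All.tabulate⁻ (xs≤max 0 (List.tabulate degree))

  γ₁≡ : ∀ k S → QuasiperfectDominating k S →
    (∀ S′ → QuasiperfectDominating k S′ → ∣ S ∣ ≤ ∣ S′ ∣) → γ₁ G k ≡ ∣ S ∣
  γ₁≡ k S qp minimal
    with m , (S₀ , qp₀ , refl) , lower ←
      minimumCardinality (QuasiperfectDominating k) (quasiperfectDominating? k)
        (full , quasiperfectDominating-⊤ k) =
    ≤-antisym (lower S qp) (minimal S₀ qp₀)

  -- No vertex sees more than `maxDegree` vertices of any set, so at this value of `k` every
  -- dominating set is quasiperfect.
  γ₁≡γ : ∀ {Δ} → Graph.maxDegree G ≡ Δ → γ₁ G Δ ≡ γ G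
  γ₁≡γ refl
    with m , (S , qp , refl) , lower ←
      minimumCardinality (QuasiperfectDominating maxDegree) (quasiperfectDominating? maxDegree)
        (full , quasiperfectDominating-⊤ maxDegree)
    with m′ , (S′ , dom , refl) , lower′ ←
      minimumCardinality Dominating dominating? (full , dominating-⊤) =
    ≤-antisym
      (lower S′ (dom , λ v _ → ≤-trans (∣p∩q∣≤∣p∣ (neighbours v) S′) (degree≤maxDegree v)))
      (lower′ S (proj₁ qp))

-- Being dominated means having at least one inside neighbour, so both halves of
-- `QuasiperfectDominating k` become one condition per vertex.
Good : ℕ → Bool → ℕ → Set
Good k true  n = ⊤
Good k false n = 1 ≤ n × n ≤ k

module _ (t : Tree) where
  open Graph (graph t) hiding (sym)

  quasiperfectDominating⇒each : ∀ {k} L → QuasiperfectDominating k (subset t L) → Each (Good k) t L 0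
  quasiperfectDominating⇒each {k} L (dom , bounded) = each⁺ t L 0 good
    where
    good : ∀ v → Good k (lookup (subset t L) v) (inside t L 0 v)
    good v rewrite inside-0 t L v with lookup (subset t L) v in eq
    ... | true  = tt
    ... | false =
      let v∉S = λ v∈S → case trans (sym eq) ([]=⇒lookup v∈S) of λ ()
          u , u∈S , v∼u = dom v v∉S
      in x∈p⇒1≤∣p∣ (x∈p∩q⁺ (v∼u⇒u∈neighbours (graph t) v∼u , u∈S)) , bounded v v∉S

  each⇒quasiperfectDominating : ∀ {k} L → Each (Good k) t L 0 → QuasiperfectDominating k (subset t L)
  each⇒quasiperfectDominating {k} L each =
    (λ v v∉S →
      let u , u∈ = 1≤∣p∣⇒nonempty _ (proj₁ (good v v∉S))
          u∈N , u∈S = x∈p∩q⁻ (neighbours v) (subset t L) u∈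
      in u , u∈S , u∈neighbours⇒v∼u (graph t) u∈N) ,
    λ v v∉S → proj₂ (good v v∉S)
    where
    good : ∀ v → v ∉ subset t L →
      1 ≤ ∣ neighbours v ∩ subset t L ∣ × ∣ neighbours v ∩ subset t L ∣ ≤ k
    good v v∉S with each⁻ t L 0 each v
    ... | p rewrite inside-0 t L v with lookup (subset t L) v in eq
    ... | true  = contradiction (lookup⇒[]= v (subset t L) eq) v∉S
    ... | false = p

  -- Lets degrees be computed by the same recursion `Each` as domination.
  inside-allInside : ∀ v → inside t (allInside t) 0 v ≡ degree v
  inside-allInside v rewrite inside-0 t (allInside t) v | subset-allInside t =
    cong ∣_∣ (∩-identityʳ (neighbours v))

  each⇒maxDegree≤ : ∀ {n} → Each (λ _ d → d ≤ n) t (allInside t) 0 → maxDegree ≤ n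
  each⇒maxDegree≤ each = maxDegree≤⁺ (graph t) λ v →
    subst (_≤ _) (inside-allInside v) (each⁻ t (allInside t) 0 each v)

  each-≤maxDegree : Each (λ _ d → d ≤ maxDegree) t (allInside t) 0
  each-≤maxDegree = each⁺ t (allInside t) 0 λ v →
    subst (_≤ maxDegree) (sym (inside-allInside v)) (degree≤maxDegree (graph t) v)

  γ₁-graph : ∀ k L → Each (Good k) t L 0 →
    (∀ L′ → Each (Good k) t L′ 0 → weight t L ≤ weight t L′) → γ₁ (graph t) k ≡ weight t L
  γ₁-graph k L each minimal = trans
    (γ₁≡ (graph t) k (subset t L) (each⇒quasiperfectDominating L each) lower) (∣subset∣ t L)
    where
    lower : ∀ S → QuasiperfectDominating k S → ∣ subset t L ∣ ≤ ∣ S ∣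
    lower S qp with L′ , refl ← subset-surjective t S
      rewrite ∣subset∣ t L | ∣subset∣ t L′ = minimal L′ (quasiperfectDominating⇒each L′ qp)

-- The trees and their predicted costs

rootLabel≤weight : ∀ t L → 𝟙 (rootLabel t L) ≤ weight t L
rootLabel≤weight •       b       = ≤-refl
rootLabel≤weight (s ▹ t) (K , L) = m≤n⇒m≤n+o (weight t L) (rootLabel≤weight s K)

-- The root of the bush in `gadget m` has `suc m` neighbours that should all be inside; one more
-- vertex is paid when `k < suc m`.
surplus : ℕ → ℕ → ℕ
surplus k m = 𝟙 (does (k ≤? m))

surplus≡1 : ∀ {k m} → k ≤ m → surplus k m ≡ 1
surplus≡1 {k} {m} k≤m = cong 𝟙 (dec-true (k ≤? m) k≤m)

surplus≡0 : ∀ {k m} → m < k → surplus k m ≡ 0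
surplus≡0 {k} {m} m<k = cong 𝟙 (dec-false (k ≤? m) (<⇒≱ m<k))

surplus≤1 : ∀ k m → surplus k m ≤ 1
surplus≤1 k m with ≤-<-connex k m
... | inj₁ k≤m = ≤-reflexive (surplus≡1 k≤m)
... | inj₂ m<k = ≤-trans (≤-reflexive (surplus≡0 m<k)) z≤n

surplus-suc-≤ : ∀ k m → surplus (suc k) m ≤ surplus k m
surplus-suc-≤ k m with ≤-<-connex (suc k) m
... | inj₁ k<m = ≤-trans (surplus≤1 (suc k) m) (≤-reflexive (sym (surplus≡1 (<⇒≤ k<m))))
... | inj₂ m≤k = ≤-trans (≤-reflexive (surplus≡0 m≤k)) z≤n

surplus-suc-≡ : ∀ {k m} → m ≢ k → surplus k m ≡ surplus (suc k) m
surplus-suc-≡ {k} {m} m≢k with ≤-<-connex k m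
... | inj₁ k≤m = trans (surplus≡1 k≤m) (sym (surplus≡1 (≤∧≢⇒< k≤m (≢-sym m≢k))))
... | inj₂ m<k = trans (surplus≡0 m<k) (sym (surplus≡0 (m<n⇒m<1+n m<k)))

star : ℕ → Tree
star zero    = •
star (suc n) = star n ▹ •

bush : ℕ → Tree
bush zero    = •
bush (suc m) = bush m ▹ star 2

-- w − u, where u has a leaf and is joined to the root v of bush m: v has suc m
-- neighbours, each of which wants to be inside.
gadget : ℕ → Tree
gadget m = • ▹ (• ▹ • ▹ bush m)

-- The final star only provides a vertex of degree suc δ.
chain : ℕ → List ℕ → Tree
chain δ []       = • ▹ star δ
chain δ (m ∷ ms) = • ▹ gadget m ▹ (• ▹ • ▹ (• ▹ chain δ ms))

-- Per gadget: its own cost, then 1 for c or its leaf, while z and l are free. The final 1 pays for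
-- the last star.
cost : ℕ → List ℕ → ℕ
cost k []       = 1
cost k (m ∷ ms) = (suc m + surplus k m) + (1 + cost k ms)

cost-suc-≤ : ∀ k ms → cost (suc k) ms ≤ cost k ms
cost-suc-≤ k []       = ≤-refl
cost-suc-≤ k (m ∷ ms) = +-mono-≤ (+-monoʳ-≤ (suc m) (surplus-suc-≤ k m)) (s≤s (cost-suc-≤ k ms))

cost-suc-≡ : ∀ {k ms} → All (_≢ k) ms → cost k ms ≡ cost (suc k) ms
cost-suc-≡ []                       = refl
cost-suc-≡ (_∷_ {x = m} m≢k ms≢k) =
  cong₂ (λ s c → (suc m + s) + suc c) (surplus-suc-≡ m≢k) (cost-suc-≡ ms≢k)

cost-suc-< : ∀ {k ms} → k List.∈ ms → cost (suc k) ms < cost k ms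
cost-suc-< {k} {_ ∷ ms} (here refl) = +-mono-<-≤ (+-monoʳ-< (suc k) surplus<) (s≤s (cost-suc-≤ k ms))
  where
  surplus< : surplus (suc k) k < surplus k k
  surplus< rewrite surplus≡0 (n<1+n k) | surplus≡1 (≤-refl {k}) = s≤s z≤n
cost-suc-< {k} {m ∷ ms} (there k∈ms) =
  +-mono-≤-< (+-monoʳ-≤ (suc m) (surplus-suc-≤ k m)) (s≤s (cost-suc-< k∈ms))

-- Lower bounds

module _ {k : ℕ} where

  leaf-bound : ∀ {s} (K : Labelling s) b {c} → Each (Good k) (s ▹ •) (K , b) c →
    1 ≤ 𝟙 (rootLabel s K) + 𝟙 b
  leaf-bound {s} K true  _              = m≤n+m 1 (𝟙 (rootLabel s K))
  leaf-bound     K false (_ , good , _) = m≤n⇒m≤n+o 0 good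

  -- The root is counted twice, since an outside root forces both leaves inside: giving it up costs
  -- one vertex more.
  cherry-bound : ∀ L c → Each (Good k) (star 2) L c → 2 ≤ 𝟙 (rootLabel (star 2) L) + weight (star 2) L
  cherry-bound ((true  , a)     , b)     c _                        = s≤s (s≤s z≤n)
  cherry-bound ((false , true)  , true)  c _                        = s≤s (s≤s z≤n)
  cherry-bound ((false , true)  , false) c (_ , () , _)
  cherry-bound ((false , false) , b)     c ((_ , () , _) , _)

  -- Each star costs at least 1. Taking the root, or giving up the centre of a star, costs one more;
  -- otherwise the outside root sees all `m` centres besides the `c` vertices elsewhere, which `k`
  -- must allow.
  bush-bound : ∀ m L c → Each (Good k) (bush m) L c →
    m < weight (bush m) L ⊎ (m ≤ weight (bush m) L × c + m ≤ k)
  bush-bound zero true  c _         = inj₁ (s≤s z≤n)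
  bush-bound zero false c (_ , c≤k) = inj₂ (z≤n , subst (_≤ k) (sym (+-identityʳ c)) c≤k)
  bush-bound (suc m) (K , L) c (eachᴷ , eachᴸ) =
    extend (rootLabel (star 2) L) (rootLabel≤weight (star 2) L) (cherry-bound L _ eachᴸ)
      (bush-bound m K _ eachᴷ)
    where
    -- `r` is the label of the centre of the last star. If inside, it is merely regrouped from `c`
    -- to `m`; if outside, the star costs 2 and the first alternative holds whatever the rest of the
    -- bush does.
    extend : ∀ {w w′} r → 𝟙 r ≤ w′ → 2 ≤ 𝟙 r + w′ → m < w ⊎ (m ≤ w × (𝟙 r + c) + m ≤ k) →
      suc m < w + w′ ⊎ (suc m ≤ w + w′ × c + suc m ≤ k)
    extend {w} {w′} true 1≤w′ _ (inj₁ m<w) =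
      inj₁ (subst (_≤ w + w′) (+-comm (suc m) 1) (+-mono-≤ m<w 1≤w′))
    extend {w} {w′} true 1≤w′ _ (inj₂ (m≤w , c+m<k)) = inj₂
      ( subst (_≤ w + w′) (+-comm m 1) (+-mono-≤ m≤w 1≤w′)
      , subst (_≤ k) (sym (+-suc c m)) c+m<k)
    extend {w} {w′} false _ 2≤w′ bound =
      inj₁ (subst (_≤ w + w′) (+-comm m 2) (+-mono-≤ ([ <⇒≤ , proj₁ ]′ bound) 2≤w′))

  -- c counts the vertex z above the gadget: when u is outside, w costs an extra vertex,
  -- either w itself or z.
  gadget-bound : ∀ m L c → Each (Good k) (gadget m) L c → suc m + surplus k m ≤ c + weight (gadget m) L
  -- With `u` inside, the bush is given the count 1, so the second alternative of `bush-bound` reads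
  -- `m < k`, where the surplus vanishes.
  gadget-bound m (w , ((true , a) , B)) c (_ , _ , each) =
    m≤n⇒m≤o+n c (m≤n⇒m≤o+n (𝟙 w) (s≤s (m≤n⇒m≤o+n (𝟙 a) (bound (bush-bound m B _ each)))))
    where
    bound : m < weight (bush m) B ⊎ (m ≤ weight (bush m) B × m < k) → m + surplus k m ≤ weight (bush m) B
    bound (inj₁ m<w) =
      ≤-trans (+-monoʳ-≤ m (surplus≤1 k m)) (subst (_≤ weight (bush m) B) (+-comm 1 m) m<w)
    bound (inj₂ (m≤w , m<k)) rewrite surplus≡0 m<k =
      subst (_≤ weight (bush m) B) (sym (+-identityʳ m)) m≤w
  gadget-bound m (w , ((false , a) , B)) c (goodʷ , eachᵘ , each) =
    begin
      suc m + surplus k m                    ≤⟨ +-monoʳ-≤ (suc m) (surplus≤1 k m) ⟩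
      suc m + 1                              ≡⟨ +-comm (suc m) 1 ⟩
      1 + (1 + m)                            ≤⟨ +-mono-≤ (dominated w goodʷ)
                                                  (+-mono-≤ (leaf-bound {s = •} false a eachᵘ) m≤w) ⟩
      (c + 𝟙 w) + (𝟙 a + weight (bush m) B)  ≡⟨ +-assoc c (𝟙 w) _ ⟩
      c + (𝟙 w + (𝟙 a + weight (bush m) B))  ∎
    where
    open ≤-Reasoning
    -- As `u` is outside, only the `c` vertices above can dominate `w`.
    dominated : ∀ w → Good k w c → 1 ≤ c + 𝟙 w
    dominated true  _         = m≤n+m 1 c
    dominated false (1≤c , _) = m≤n⇒m≤n+o 0 1≤c

    m≤w : m ≤ weight (bush m) B
    m≤w = [ <⇒≤ , proj₁ ]′ (bush-bound m B _ each)

  -- The label of z is charged to its gadget as the `c` of `gadget-bound`. No summand depends on the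
  -- count at the root of the chain, so the pieces are bounded separately. `suc δ` exposes a leaf of
  -- the final star.
  chain-bound : ∀ δ ms L c → Each (Good k) (chain (suc δ) ms) L c →
    cost k ms ≤ weight (chain (suc δ) ms) L
  chain-bound δ [] (z , (K , b)) c (_ , each) = m≤n⇒m≤o+n (𝟙 z)
    (≤-trans (leaf-bound {s = star δ} K b each) (+-monoˡ-≤ (𝟙 b) (rootLabel≤weight (star δ) K)))
  chain-bound δ (m ∷ ms) ((z , G) , ((h , a) , (l , R))) c ((_ , eachᴳ) , (eachʰ , (_ , eachᴿ))) =
    +-mono-≤ (gadget-bound m G _ eachᴳ)
      (+-mono-≤ (leaf-bound {s = •} h a eachʰ) (m≤n⇒m≤o+n (𝟙 l) (chain-bound δ ms R _ eachᴿ)))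

-- Labellings that attain the bounds

centred : ∀ n → Labelling (star n)
centred zero    = true
centred (suc n) = centred n , false

rootLabel-centred : ∀ n → rootLabel (star n) (centred n) ≡ true
rootLabel-centred zero    = refl
rootLabel-centred (suc n) = rootLabel-centred n

weight-centred : ∀ n → weight (star n) (centred n) ≡ 1
weight-centred zero    = refl
weight-centred (suc n) = trans (+-identityʳ _) (weight-centred n)

bushLabelling : Bool → ∀ m → Labelling (bush m)
bushLabelling b zero    = b
bushLabelling b (suc m) = bushLabelling b m , centred 2

weight-bushLabelling : ∀ b m → weight (bush m) (bushLabelling b m) ≡ m + 𝟙 b
weight-bushLabelling b zero    = refl
weight-bushLabelling b (suc m) = trans (+-comm _ 1) (cong suc (weight-bushLabelling b m))

module _ (k δ : ℕ) (1≤k : 1 ≤ k) where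

  centred-good : ∀ n c → Each (Good k) (star n) (centred n) c
  centred-good zero    c = tt
  centred-good (suc n) c rewrite rootLabel-centred n = centred-good n c , ≤-refl , 1≤k

  bushLabelling-good : ∀ b m c → Good k b (c + m) → Each (Good k) (bush m) (bushLabelling b m) c
  bushLabelling-good b zero    c good = subst (Good k b) (+-identityʳ c) good
  bushLabelling-good b (suc m) c good =
    bushLabelling-good b m (suc c) (subst (Good k b) (+-suc c m) good) ,
    centred-good 2 (𝟙 (rootLabel (bush m) (bushLabelling b m)))

  -- `u` and the centres of the stars are inside. The root of the bush then sees `suc m` inside
  -- vertices, and joins them exactly when this exceeds `k`.
  gadgetLabelling : ∀ m → Labelling (gadget m)
  gadgetLabelling m = false , ((true , false) , bushLabelling (does (k ≤? m)) m)

  weight-gadgetLabelling : ∀ m → weight (gadget m) (gadgetLabelling m) ≡ suc m + surplus k m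
  weight-gadgetLabelling m = cong suc (weight-bushLabelling (does (k ≤? m)) m)

  gadgetLabelling-good : ∀ m → Each (Good k) (gadget m) (gadgetLabelling m) 0
  gadgetLabelling-good m =
    (≤-refl , 1≤k) , ((tt , (≤-refl , 1≤k)) , bushLabelling-good _ m 1 good)
    where
    good : Good k (does (k ≤? m)) (suc m)
    good with ≤-<-connex k m
    ... | inj₁ k≤m rewrite dec-true (k ≤? m) k≤m = tt
    ... | inj₂ m<k rewrite dec-false (k ≤? m) (<⇒≱ m<k) = s≤s z≤n , m<k

  -- Every outside vertex except the roots of bushes has exactly one inside neighbour, which every
  -- `k ≥ 1` permits; z and l have c, and the last z has the centre of the star.
  chainLabelling : ∀ ms → Labelling (chain δ ms)
  chainLabelling []       = false , centred δ
  chainLabelling (m ∷ ms) = (false , gadgetLabelling m) , ((true , false) , (false , chainLabelling ms))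

  rootLabel-chainLabelling : ∀ ms → rootLabel (chain δ ms) (chainLabelling ms) ≡ false
  rootLabel-chainLabelling []      = refl
  rootLabel-chainLabelling (_ ∷ _) = refl

  weight-chainLabelling : ∀ ms → weight (chain δ ms) (chainLabelling ms) ≡ cost k ms
  weight-chainLabelling []       = weight-centred δ
  weight-chainLabelling (m ∷ ms) =
    cong₂ (λ g c → g + suc c) (weight-gadgetLabelling m) (weight-chainLabelling ms)

  chainLabelling-good : ∀ ms → Each (Good k) (chain δ ms) (chainLabelling ms) 0
  chainLabelling-good [] rewrite rootLabel-centred δ = (≤-refl , 1≤k) , centred-good δ 0
  chainLabelling-good (m ∷ ms) rewrite rootLabel-chainLabelling ms =
    ((≤-refl , 1≤k) , gadgetLabelling-good m) ,
    ((tt , (≤-refl , 1≤k)) , ((≤-refl , 1≤k) , chainLabelling-good ms))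

γ₁-chain : ∀ {k} δ ms → 1 ≤ k → γ₁ (graph (chain (suc δ) ms)) k ≡ cost k ms
γ₁-chain {k} δ ms 1≤k = trans
  (γ₁-graph t k L (chainLabelling-good k (suc δ) 1≤k ms)
    λ L′ each → subst (_≤ weight t L′) (sym weight≡) (chain-bound δ ms L′ 0 each))
  weight≡
  where
  t = chain (suc δ) ms
  L = chainLabelling k (suc δ) 1≤k ms
  weight≡ = weight-chainLabelling k (suc δ) 1≤k ms

-- The maximum degree

module _ {n : ℕ} where

  -- The inside neighbours of a vertex are all its neighbours when every label is inside.
  DegreesAtMost : Tree → ℕ → Set
  DegreesAtMost t = Each (λ _ d → d ≤ n) t (allInside t)

  star-degrees : ∀ {i} c → 1 ≤ n → i + c ≤ n → DegreesAtMost (star i) c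
  star-degrees {zero}  c 1≤n c≤n = c≤n
  star-degrees {suc i} c 1≤n i+c≤n rewrite rootLabel-allInside (star i) =
    star-degrees (suc c) 1≤n (subst (_≤ n) (sym (+-suc i c)) i+c≤n) , 1≤n

  bush-degrees : ∀ {m} c → 3 ≤ n → m + c ≤ n → DegreesAtMost (bush m) c
  bush-degrees {zero}  c 3≤n c≤n = c≤n
  bush-degrees {suc m} c 3≤n m+c≤n rewrite rootLabel-allInside (bush m) =
    bush-degrees (suc c) 3≤n (subst (_≤ n) (sym (+-suc m c)) m+c≤n) ,
    star-degrees {2} 1 (≤-trans (s≤s z≤n) 3≤n) 3≤n

  -- The centre of the final star has degree `suc δ` and the root of a bush `suc m`; all other
  -- vertices have degree at most 3. Here `c ≤ 1` counts the preceding l.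
  chain-degrees : ∀ {δ ms} c → 3 ≤ n → c ≤ 1 → suc δ ≤ n → All (_< n) ms → DegreesAtMost (chain δ ms) c
  chain-degrees {δ} c 3≤n c≤1 δ<n [] rewrite rootLabel-allInside (star δ) =
    ≤-trans (s≤s c≤1) (≤-trans (n≤1+n 2) 3≤n) ,
    star-degrees 1 (≤-trans (s≤s z≤n) 3≤n) (subst (_≤ n) (+-comm 1 δ) δ<n)
  chain-degrees {δ} {m ∷ ms} c 3≤n c≤1 δ<n (m<n ∷ ms<n)
    rewrite rootLabel-allInside (bush m) | rootLabel-allInside (chain δ ms) =
    (≤-trans (s≤s (s≤s c≤1)) 3≤n , (2≤n , ((3≤n , 1≤n) ,
      bush-degrees 1 3≤n (subst (_≤ n) (+-comm 1 m) m<n)))) ,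
    ((3≤n , 1≤n) , (2≤n , chain-degrees 1 3≤n ≤-refl δ<n ms<n))
    where
    2≤n = ≤-trans (n≤1+n 2) 3≤n
    1≤n = ≤-trans (n≤1+n 1) 2≤n

  star-degrees⁻ : ∀ i c → DegreesAtMost (star i) c → i + c ≤ n
  star-degrees⁻ zero    c c≤n        = c≤n
  star-degrees⁻ (suc i) c (each , _) = subst (_≤ n) (+-suc i c) (star-degrees⁻ i (suc c) each)

  chain-degrees⁻ : ∀ δ ms c → DegreesAtMost (chain δ ms) c → suc δ ≤ n
  chain-degrees⁻ δ []       c (_ , each)             = subst (_≤ n) (+-comm δ 1) (star-degrees⁻ δ 1 each)
  chain-degrees⁻ δ (m ∷ ms) c (_ , (_ , (_ , each))) = chain-degrees⁻ δ ms 1 each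

maxDegree-chain : ∀ {δ ms} → 2 ≤ δ → All (_≤ δ) ms → Graph.maxDegree (graph (chain δ ms)) ≡ suc δ
maxDegree-chain {δ} {ms} 2≤δ ms≤δ = ≤-antisym
  (each⇒maxDegree≤ (chain δ ms) (chain-degrees 0 (s≤s 2≤δ) z≤n ≤-refl (All.map s≤s ms≤δ)))
  -- The bound `n` is here the maximum degree itself; the centre of the final star forces it up to
  -- `suc δ`.
  (chain-degrees⁻ δ ms 0 (each-≤maxDegree (chain δ ms)))

-- Realising the prescribed symbols

-- surplus k 0 vanishes for every k ≥ 1, so a gadget of size 0 never affects a comparison.
gadgetSize : Symbol → ℕ → ℕ
gadgetSize equal   i = 0
gadgetSize greater i = suc i

gadgetSize≤ : ∀ s {i n} → i < n → gadgetSize s i ≤ n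
gadgetSize≤ equal   _   = z≤n
gadgetSize≤ greater i<n = i<n

sizes : ∀ {n} → (Fin n → Symbol) → List ℕ
sizes ⊛ = List.tabulate λ i → gadgetSize (⊛ i) (toℕ i)

-- From `k` to `suc k` the cost falls if `k` is among the sizes and stays otherwise. Indices start
-- at 0, so index `i` governs the step from `1 + toℕ i`.
cost-symbol : ∀ {n} (⊛ : Fin n → Symbol) i →
  ⟦ ⊛ i ⟧ (cost (1 + toℕ i) (sizes ⊛)) (cost (2 + toℕ i) (sizes ⊛))
cost-symbol ⊛ i with ⊛ i in eq
... | equal   = cost-suc-≡ (All.tabulate⁺ size≢)
  where
  size≢ : ∀ j → gadgetSize (⊛ j) (toℕ j) ≢ suc (toℕ i)
  size≢ j size≡ with ⊛ j in eqⱼ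
  -- Size 0 is no successor, so `⊛ j` is `greater`; equal sizes then give `j ≡ i`, although `⊛ i` is
  -- `equal`.
  ... | greater with refl ← Fin.toℕ-injective (suc-injective size≡) with () ← trans (sym eq) eqⱼ
... | greater = cost-suc-<
  (subst (List._∈ sizes ⊛) (cong (λ s → gadgetSize s (toℕ i)) eq) (∈-tabulate⁺ i))

-- G is kept variable because γ₁ of a concrete tree unfolds to the search for a minimum.
γ₁-symbol : ∀ {n} (⊛ : Fin n → Symbol) G (f : ℕ → ℕ) → (∀ k → 1 ≤ k → γ₁ G k ≡ f k) →
  (∀ i → ⟦ ⊛ i ⟧ (f (1 + toℕ i)) (f (2 + toℕ i))) →
  ∀ i → ⟦ ⊛ i ⟧ (γ₁ G (1 + toℕ i)) (γ₁ G (2 + toℕ i))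
γ₁-symbol ⊛ G f γ₁≡f symbol i =
  subst₂ ⟦ ⊛ i ⟧ (sym (γ₁≡f _ (s≤s z≤n))) (sym (γ₁≡f _ (s≤s z≤n))) (symbol i)

theorem4 : (Δ : ℕ) → 3 ≤ Δ → (⊛ : Fin (Δ ∸ 1) → Symbol) →
    Σ[ T ∈ Graph ]
    Graph.IsTree T
    × Graph.maxDegree T ≡ Δ
    × ((i : Fin (Δ ∸ 1)) → ⟦ ⊛ i ⟧ (γ₁ T (1 + toℕ i)) (γ₁ T (2 + toℕ i)))
    × γ₁ T Δ ≡ γ T
-- The chain takes `suc δ`, which is Δ - 1: the centre of the final star has that many leaves and
-- one further neighbour, and no gadget size exceeds Δ - 1.
theorem4 (suc (suc δ)) (s≤s 2≤δ) ⊛ =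
  graph (chain (suc δ) (sizes ⊛)) ,
  graph-isTree (chain (suc δ) (sizes ⊛)) ,
  maxDegree≡Δ ,
  γ₁-symbol ⊛ (graph (chain (suc δ) (sizes ⊛))) (λ k → cost k (sizes ⊛))
    (λ k → γ₁-chain δ (sizes ⊛)) (cost-symbol ⊛) ,
  γ₁≡γ (graph (chain (suc δ) (sizes ⊛))) {suc (suc δ)} maxDegree≡Δ
  where
  maxDegree≡Δ : Graph.maxDegree (graph (chain (suc δ) (sizes ⊛))) ≡ suc (suc δ)
  maxDegree≡Δ = maxDegree-chain {suc δ} {sizes ⊛} 2≤δ (All.tabulate⁺ λ j → gadgetSize≤ (⊛ j) (toℕ<n j))
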